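{- Let $G(B(3,n),B_Lb_D)$ be the two-bishop game graph on a $3\times n$ grid. Then $$3\leq \beta(G(B(3,n),B_Lb_D))\leq 4.$$
   Context: The bishop graph $B(a,b)$ is the simple graph whose vertices are the squares of an $a\times b$ grid, two distinct squares being adjacent if and only if a bishop can move from one to the other in chess, i.e. they lie on a common diagonal (in any diagonal direction, at any distance): squares $(i,j)\ne(i',j')$ are adjacent iff $|i-i'|=|j-j'|$. Colour the squares light and dark as on a chessboard (by the parity of $i+j$). $B_L(a,b)$ and $B_D(a,b)$ denote the subgraphs of $B(a,b)$ induced on the light and on the dark squares, respectively. $B_Lb_D$ denotes the position with a single bishop on one square of each colour (so that neither threatens the other). The game graph $G(B(a,b),B_Lb_D)$ is the Cartesian product $B_L(a,b)\,\square\,B_D(a,b)$ with each edge replaced by a pair of symmetric arcs, and it is treated as its underlying simple undirected graph $B_L(a,b)\,\square\,B_D(a,b)$. Here the Cartesian product $X\,\square\,Y$ has vertex set $V(X)\times V(Y)$, with $(x,y)$ and $(x',y')$ adjacent iff either $x=x'$ and $yy'$ is an edge of $Y$, or $y=y'$ and $xx'$ is an edge of $X$. Metric dimension: for an ordered set $S=(u_1,\dots,u_k)$ of vertices of a simple graph $G$, the distance vector of a vertex $v$ is $(d(u_1,v),\dots,d(u_k,v))$, where $d$ is the usual graph distance. $S$ is a resolving set if distinct vertices have distinct distance vectors. The metric dimension $\beta(G)$ is the minimum cardinality of a resolving set.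
   Formalization: The theorem is proved for n ≥ 3; the statement sets no bound on n, but the lower bound 3 fails for smaller grids (for n = 2 the game graph is the product of two 3-vertex paths, with metric dimension 2; for n = 1 it is 1). -}

module Defs where

open import Data.Fin.Base using (Fin; toℕ)
open import Data.Maybe.Base using (Maybe; just; nothing)
open import Data.Nat.Base using (ℕ; zero; suc; _+_; _≤_; ∣_-_∣; parity)
open import Data.Nat.Properties using (∣-∣-comm)
open import Data.Parity.Base using (Parity; 0ℙ; 1ℙ)
open import Data.Product.Base using (Σ-syntax; _×_; _,_; proj₁; proj₂)
open import Data.Refinement using (Refinement-syntax; value)
open import Data.Sum.Base using (_⊎_; inj₁; inj₂)
open import Data.Vec.Base using (Vec)
open import Data.Vec.Relation.Binary.Pointwise.Inductive using (Pointwise)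
open import Data.Vec.Relation.Unary.Unique.Propositional using (Unique)
open import Relation.Binary.Core using (Rel)
open import Relation.Binary.Definitions using (Symmetric)
open import Relation.Binary.PropositionalEquality
  using (_≡_; _≢_; refl; sym; trans; ≢-sym)
open import Relation.Nullary.Negation using (¬_)

record SimpleGraph : Set₁ where
  field
    Vertex      : Set
    Adj         : Rel Vertex _
    adj-sym     : Symmetric Adj
    adj-irrefl  : ∀ {v} → ¬ Adj v v

open SimpleGraph

-- The membership proofs of the vertex subset are irrelevant, so that vertices
-- of the induced subgraph are equal exactly when they are equal in G.
induced : (G : SimpleGraph) → (Vertex G → Set) → SimpleGraph
induced G P = record
  { Vertex     = [ v ∈ Vertex G ∣ P v ]
  ; Adj        = λ v w → Adj G (value v) (value w)
  ; adj-sym    = adj-sym G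
  ; adj-irrefl = adj-irrefl G
  }

infixr 6 _□_

_□_ : SimpleGraph → SimpleGraph → SimpleGraph
X □ Y = record
  { Vertex     = Vertex X × Vertex Y
  ; Adj        = λ (x , y) (x′ , y′) →
                   (x ≡ x′ × Adj Y y y′) ⊎ (y ≡ y′ × Adj X x x′)
  ; adj-sym    = λ { (inj₁ (eq , e)) → inj₁ (sym eq , adj-sym Y e)
                   ; (inj₂ (eq , e)) → inj₂ (sym eq , adj-sym X e) }
  ; adj-irrefl = λ { (inj₁ (_ , e)) → adj-irrefl Y e
                   ; (inj₂ (_ , e)) → adj-irrefl X e }
  }

data Walk (G : SimpleGraph) : Vertex G → Vertex G → ℕ → Set where
  []  : ∀ {v} → Walk G v v zero
  _∷_ : ∀ {u v w n} → Adj G u v → Walk G v w n → Walk G u w (suc n)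

-- `nothing` is the infinite distance between different components.
IsDistance : (G : SimpleGraph) → Vertex G → Vertex G → Maybe ℕ → Set
IsDistance G u v (just d) = Walk G u v d × (∀ m → Walk G u v m → d ≤ m)
IsDistance G u v nothing  = ∀ m → ¬ Walk G u v m

IsDistanceVector : (G : SimpleGraph) → ∀ {k} →
                   Vec (Vertex G) k → Vertex G → Vec (Maybe ℕ) k → Set
IsDistanceVector G S v ds = Pointwise (λ u d → IsDistance G u v d) S ds

-- Entries of S are pairwise different, so its length k is its cardinality.
IsResolving : (G : SimpleGraph) → ∀ {k} → Vec (Vertex G) k → Set
IsResolving G S =
  Unique S ×
  (∀ v w → v ≢ w → ∀ ds es →
     IsDistanceVector G S v ds → IsDistanceVector G S w es → ds ≢ es)

IsMetricDimension : SimpleGraph → ℕ → Set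
IsMetricDimension G β =
  (Σ[ S ∈ Vec (Vertex G) β ] IsResolving G S) ×
  (∀ k (S : Vec (Vertex G) k) → IsResolving G S → β ≤ k)

Square : ℕ → ℕ → Set
Square a b = Fin a × Fin b

bishop : ℕ → ℕ → SimpleGraph
bishop a b = record
  { Vertex     = Square a b
  ; Adj        = λ s t → s ≢ t ×
                   ∣ toℕ (proj₁ s) - toℕ (proj₁ t) ∣ ≡ ∣ toℕ (proj₂ s) - toℕ (proj₂ t) ∣
  ; adj-sym    = λ { {i , j} {i′ , j′} (s≢t , eq) →
                     ≢-sym s≢t ,
                     trans (∣-∣-comm (toℕ i′) (toℕ i))
                       (trans eq (∣-∣-comm (toℕ j) (toℕ j′))) }
  ; adj-irrefl = λ (s≢s , _) → s≢s refl
  }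

colour : ∀ {a b} → Square a b → Parity
colour (i , j) = parity (toℕ i + toℕ j)

lightBishop : ℕ → ℕ → SimpleGraph
lightBishop a b = induced (bishop a b) (λ s → colour s ≡ 0ℙ)

darkBishop : ℕ → ℕ → SimpleGraph
darkBishop a b = induced (bishop a b) (λ s → colour s ≡ 1ℙ)

-- G(B(a,b), B_L b_D), as its underlying undirected graph.
twoBishopGame : ℕ → ℕ → SimpleGraph
twoBishopGame a b = lightBishop a b □ darkBishop a b

{-# OPTIONS --safe #-}
module Submission where

open import Defs
open import Data.Fin.Base using (Fin; zero; suc; toℕ; fromℕ<; inject₁)
open import Data.Fin.Properties
  using (any?; pigeonhole; fromℕ<-injective; toℕ-fromℕ<; toℕ-injective; toℕ<n; toℕ-inject₁)
  renaming (_≟_ to _≟ᶠ_; <⇒≢ to <ᶠ⇒≢)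
open import Data.Irrelevant using ([_])
open import Data.Maybe.Base using (Maybe; just; nothing)
open import Data.Maybe.Properties using (just-injective) renaming (≡-dec to ≡-decᵐ)
open import Data.Nat.Base
open import Data.Nat.Properties renaming (_≟_ to _≟ⁿ_)
open import Data.Nat.Solver using (module +-*-Solver)
open import Data.Parity.Base using (Parity; 0ℙ; 1ℙ; _⁻¹) renaming (_+_ to _+ℙ_)
open import Data.Parity.Properties
  using (p≢p⁻¹; ⁻¹-selfInverse; suc-homo-⁻¹; +-homo-+) renaming (_≟_ to _≟ℙ_)
open import Data.Product.Base
  using (_×_; _,_; proj₁; proj₂; Σ-syntax; ∃-syntax; uncurry)
open import Data.Product.Properties using (≡-dec)
open import Data.Refinement using (Refinement; _,_; value; value-injective)
  renaming (_≟_ to ≟-refinement)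
open import Data.Sum.Base using (_⊎_; inj₁; inj₂)
open import Data.Vec.Base as Vec using (Vec; []; _∷_)
open import Data.Vec.Properties using (∷-injective) renaming (≡-dec to ≡-decᵛ)
open import Data.Vec.Relation.Binary.Pointwise.Inductive using ([]; _∷_)
open import Data.Vec.Relation.Unary.All using ([]; _∷_)
open import Data.Vec.Relation.Unary.AllPairs using (allPairs?)
open import Data.Vec.Relation.Unary.Unique.Propositional using (Unique; []; _∷_)
open import Function.Base using (_∘_)
open import Function.Definitions using (Injective)
open import Relation.Binary.Definitions using (DecidableEquality)
open import Relation.Binary.PropositionalEquality
open import Relation.Nullary.Decidable
  using (Dec; yes; no; map′; ¬?; _×-dec_; _→-dec_; decidable-stable; recompute)
open import Relation.Nullary.Negation using (¬_; contradiction)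

-- Distances in the Cartesian product X □ Y add up.  Two vertices a, b that
-- resolve X and three vertices c, d, e that doubly resolve Y (differences of
-- distances separate vertices) therefore give the resolving set
-- (a,c), (b,c), (a,d), (a,e) of X □ Y.  On the light squares, a and b are the
-- two corners of column 0; on the dark squares, c is the square of column 0 and
-- d, e are the two squares of the last odd column.  Conversely, if two vertices
-- resolve a graph, then each of them has at most 3 neighbours, whereas every
-- vertex of the game graph has at least 4.  Whether three vertices suffice
-- depends on n and is decided by exhaustive search.

open SimpleGraph

-- Exhaustive search

-- Finiteness in the form of deciding existential statements; it passes to products, refinements and
-- vectors without any enumeration.
Searchable : Set → Set₁
Searchable A = {P : A → Set} → (∀ a → Dec (P a)) → Dec (Σ[ a ∈ A ] P a)

search-all : ∀ {A} → Searchable A → {P : A → Set} → (∀ a → Dec (P a)) → Dec (∀ a → P a)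
search-all search P? with search (¬? ∘ P?)
... | yes (a , ¬p) = no λ p → ¬p (p a)
... | no ¬∃        = yes λ a → decidable-stable (P? a) λ ¬p → ¬∃ (a , ¬p)

search-Fin : ∀ {n} → Searchable (Fin n)
search-Fin = any?

search-× : ∀ {A B} → Searchable A → Searchable B → Searchable (A × B)
search-× searchA searchB P? =
  map′ (λ (a , b , p) → (a , b) , p) (λ ((a , b) , p) → a , b , p)
    (searchA λ a → searchB λ b → P? (a , b))

search-refinement : ∀ {A} {Q : A → Set} → Searchable A → (∀ a → Dec (Q a)) →
                    Searchable (Refinement A Q)
search-refinement {A} {Q} search Q? {P} P? =
  map′ (λ (a , q , p) → (a , [ q ]) , p)
       (λ { ((a , [ q ]) , p) → a , recompute (Q? a) q , p })
       (search below)
  where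
  below : ∀ a → Dec (Σ[ q ∈ Q a ] P (a , [ q ]))
  -- The membership proof in a refinement is irrelevant, so testing `P` with the one proof found by
  -- `Q?` covers all proofs.
  below a with Q? a
  ... | no ¬q = no λ (q , _) → ¬q q
  ... | yes q = map′ (q ,_) (λ (_ , p) → p) (P? (a , [ q ]))

search-Vec : ∀ {A} → Searchable A → ∀ k → Searchable (Vec A k)
search-Vec search zero    P? = map′ ([] ,_) (λ { ([] , p) → p }) (P? [])
search-Vec search (suc k) P? =
  map′ (λ (a , as , p) → a ∷ as , p) (λ { (a ∷ as , p) → a , as , p })
    (search λ a → search-Vec search k λ as → P? (a ∷ as))

-- Distances

-- Values in `ℕ` rule out infinite distances, so such a function also witnesses that `G` is
-- connected.
record DistanceFunction (G : SimpleGraph) : Set where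
  field
    dist       : Vertex G → Vertex G → ℕ
    isDistance : ∀ u v → IsDistance G u v (just (dist u v))

  geodesic : ∀ u v → Walk G u v (dist u v)
  geodesic u v = proj₁ (isDistance u v)

  dist-≤ : ∀ {u v m} → Walk G u v m → dist u v ≤ m
  dist-≤ {u} {v} = proj₂ (isDistance u v) _

infixr 5 _++ʷ_

_++ʷ_ : ∀ {G u v w m n} → Walk G u v m → Walk G v w n → Walk G u w (m + n)
[]      ++ʷ q = q
(e ∷ p) ++ʷ q = e ∷ (p ++ʷ q)

isDistance-unique : ∀ {G u v d e} →
                    IsDistance G u v (just d) → IsDistance G u v e → e ≡ just d
isDistance-unique {e = just _}  (p , p-min) (q , q-min) =
  cong just (≤-antisym (q-min _ p) (p-min _ q))
isDistance-unique {e = nothing} (p , _)     none        = contradiction p (none _)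

-- Resolving sets and the lower bound

Neighbours : ∀ G → ℕ → Vertex G → Set
Neighbours G m v = Σ[ N ∈ (Fin m → Vertex G) ] (∀ i → Adj G v (N i)) × Injective _≡_ _≡_ N

module _ {G : SimpleGraph} (D : DistanceFunction G) where
  open DistanceFunction D

  dist-self : ∀ v → dist v v ≡ 0
  dist-self v = n≤0⇒n≡0 (dist-≤ [])

  dist-adj : ∀ {u v} → Adj G u v → dist u v ≡ 1
  dist-adj {u} {v} e with dist u v | geodesic u v | dist-≤ (e ∷ [])
  ... | zero        | []    | _          = contradiction e (adj-irrefl G)
  ... | suc zero    | _     | _          = refl
  ... | suc (suc _) | _     | s≤s ()

  dist-lipschitz : ∀ u {v w} → Adj G v w → dist u w ≤ suc (dist u v)
  dist-lipschitz u {v} {w} e =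
    subst (dist u w ≤_) (+-comm (dist u v) 1) (dist-≤ (geodesic u v ++ʷ e ∷ []))

  distances : ∀ {k} → Vec (Vertex G) k → Vertex G → Vec (Maybe ℕ) k
  distances S v = Vec.map (λ u → just (dist u v)) S

  distances-correct : ∀ {k} (S : Vec (Vertex G) k) v → IsDistanceVector G S v (distances S v)
  distances-correct []      v = []
  distances-correct (u ∷ S) v = isDistance u v ∷ distances-correct S v

  distances-unique : ∀ {k} (S : Vec (Vertex G) k) v {ds} →
                     IsDistanceVector G S v ds → ds ≡ distances S v
  distances-unique []      v []       = refl
  distances-unique (u ∷ S) v (d ∷ ds) =
    cong₂ _∷_ (isDistance-unique (isDistance u v) d) (distances-unique S v ds)

  Separates : ∀ {k} → Vec (Vertex G) k → Set
  Separates S = ∀ v w → distances S v ≡ distances S w → v ≡ w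

  resolving : ∀ {k} {S : Vec (Vertex G) k} → Unique S → Separates S → IsResolving G S
  resolving {S = S} unique separates = unique , λ v w v≢w ds es p q ds≡es →
    v≢w (separates v w (trans (sym (distances-unique S v p))
                              (trans ds≡es (distances-unique S w q))))

  resolving⇒≢ : ∀ {k} {S : Vec (Vertex G) k} → IsResolving G S →
                ∀ {v w} → v ≢ w → distances S v ≢ distances S w
  resolving⇒≢ {S = S} (_ , separated) v≢w =
    separated _ _ v≢w _ _ (distances-correct S _) (distances-correct S _)

  -- `IsResolving` quantifies over all distance vectors; as these are unique, comparing the computed
  -- vectors of all pairs of vertices decides it.
  resolving? : DecidableEquality (Vertex G) → Searchable (Vertex G) →
               ∀ {k} (S : Vec (Vertex G) k) → Dec (IsResolving G S)
  resolving? _≟_ search S =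
    map′ (uncurry resolving)
         (λ r → proj₁ r , λ v w eq → decidable-stable (v ≟ w) λ v≢w → resolving⇒≢ r v≢w eq)
         (allPairs? (λ v w → ¬? (v ≟ w)) S ×-dec
          search-all search λ v → search-all search λ w →
            ≡-decᵛ (≡-decᵐ _≟ⁿ_)
                   (distances S v) (distances S w)
            →-dec v ≟ w)

  -- The neighbours of one of two landmarks are at distance 1 from it and take
  -- at most three distances from the other one.
  resolving⇒3≤ : Vertex G → (∀ v → Neighbours G 4 v) →
                 ∀ k (S : Vec (Vertex G) k) → IsResolving G S → 3 ≤ k
  resolving⇒3≤ v neighbours 0 [] r =
    contradiction refl (resolving⇒≢ r (λ eq → contradiction (inj eq) λ ()))
    where inj = proj₂ (proj₂ (neighbours v)) {zero} {suc zero}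
  resolving⇒3≤ _ neighbours 1 (a ∷ []) r with neighbours a
  ... | N , adj , inj =
    contradiction
      (cong (λ d → just d ∷ []) (trans (dist-adj (adj zero)) (sym (dist-adj (adj (suc zero))))))
      (resolving⇒≢ r (λ eq → contradiction (inj eq) λ ()))
  resolving⇒3≤ _ neighbours 2 (a ∷ b ∷ []) r with neighbours a
  ... | N , adj , inj = contradiction same (resolving⇒≢ r (λ eq → <ᶠ⇒≢ i<j (inj eq)))
    where
    -- The distances from `b` exceed `dist b a` by 1, 0 or -1, giving offsets 0, 1 and 2. No
    -- subtraction truncates, so equal offsets mean equal distances.
    offset : Fin 4 → ℕ
    offset i = suc (dist b a) ∸ dist b (N i)

    offset<3 : ∀ i → offset i < 3
    offset<3 i = s≤s (m≤n+o⇒m∸n≤o _ (dist b (N i))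
      (subst (suc (dist b a) ≤_) (+-comm 2 _) (s≤s (dist-lipschitz b (adj-sym G (adj i))))))

    collision = pigeonhole (n<1+n 3) (λ i → fromℕ< (offset<3 i))
    i = proj₁ collision
    j = proj₁ (proj₂ collision)
    i<j = proj₁ (proj₂ (proj₂ collision))

    same : distances (a ∷ b ∷ []) (N i) ≡ distances (a ∷ b ∷ []) (N j)
    same = cong₂ (λ d e → just d ∷ just e ∷ [])
      (trans (dist-adj (adj i)) (sym (dist-adj (adj j))))
      (∸-cancelˡ-≡ (dist-lipschitz b (adj i)) (dist-lipschitz b (adj j))
        (fromℕ<-injective _ _ (offset<3 i) (offset<3 j) (proj₂ (proj₂ (proj₂ collision)))))
  resolving⇒3≤ _ _ (suc (suc (suc k))) _ _ = s≤s (s≤s (s≤s z≤n))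

metricDimension-3-4 : ∀ {G} (D : DistanceFunction G) →
  DecidableEquality (Vertex G) → Searchable (Vertex G) →
  (∀ k (S : Vec (Vertex G) k) → IsResolving G S → 3 ≤ k) →
  Σ[ S ∈ Vec (Vertex G) 4 ] IsResolving G S →
  ∃[ β ] (IsMetricDimension G β × 3 ≤ β × β ≤ 4)
metricDimension-3-4 {G} D _≟_ search lower four
  with search-Vec search 3 (resolving? D _≟_ search)
... | yes three = 3 , (three , lower) , ≤-refl , n≤1+n 3
... | no ¬three = 4 , (four , above) , n≤1+n 3 , ≤-refl
  where
  above : ∀ k (S : Vec (Vertex G) k) → IsResolving G S → 4 ≤ k
  above k S r with m≤n⇒m<n∨m≡n (lower k S r)
  ... | inj₁ 4≤k  = 4≤k
  ... | inj₂ refl = contradiction (S , r) ¬three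

-- Cartesian products

module _ {X Y : SimpleGraph} where

  walk-□ : ∀ {x x′ y y′ m n} → Walk X x x′ m → Walk Y y y′ n →
           Walk (X □ Y) (x , y) (x′ , y′) (m + n)
  walk-□ (e ∷ p) q       = inj₂ (refl , e) ∷ walk-□ p q
  walk-□ []      (e ∷ q) = inj₁ (refl , e) ∷ walk-□ [] q
  walk-□ []      []      = []

  module _ (DX : DistanceFunction X) (DY : DistanceFunction Y) where
    private
      module DX = DistanceFunction DX
      module DY = DistanceFunction DY

    -- Each edge of a walk moves one coordinate only and lowers the distance in that factor by at
    -- most one.
    walk-□-≥ : ∀ {x x′ y y′ m} → Walk (X □ Y) (x , y) (x′ , y′) m →
               DX.dist x x′ + DY.dist y y′ ≤ m
    walk-□-≥ {x} {y = y} [] = ≤-reflexive (cong₂ _+_ (dist-self DX x) (dist-self DY y))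
    walk-□-≥ {x} {x′} {y} {y′} (_∷_ {v = _ , v} (inj₁ (refl , e)) p) = begin
      DX.dist x x′ + DY.dist y y′        ≤⟨ +-monoʳ-≤ (DX.dist x x′) (DY.dist-≤ (e ∷ DY.geodesic v y′)) ⟩
      DX.dist x x′ + suc (DY.dist v y′)  ≡⟨ +-suc _ _ ⟩
      suc (DX.dist x x′ + DY.dist v y′)  ≤⟨ s≤s (walk-□-≥ p) ⟩
      _                                  ∎
      where open ≤-Reasoning
    walk-□-≥ {x} {x′} {y} {y′} (_∷_ {v = v , _} (inj₂ (refl , e)) p) = begin
      DX.dist x x′ + DY.dist y y′        ≤⟨ +-monoˡ-≤ (DY.dist y y′) (DX.dist-≤ (e ∷ DX.geodesic v x′)) ⟩
      suc (DX.dist v x′ + DY.dist y y′)  ≤⟨ s≤s (walk-□-≥ p) ⟩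
      _                                  ∎
      where open ≤-Reasoning

    distance-□ : DistanceFunction (X □ Y)
    distance-□ = record
      { dist       = λ (x , y) (x′ , y′) → DX.dist x x′ + DY.dist y y′
      ; isDistance = λ (x , y) (x′ , y′) →
          walk-□ (DX.geodesic x x′) (DY.geodesic y y′) , λ _ → walk-□-≥
      }

    neighbours-□ : (∀ x → Neighbours X 2 x) → (∀ y → Neighbours Y 2 y) →
                   ∀ v → Neighbours (X □ Y) 4 v
    neighbours-□ neighboursX neighboursY (x , y)
      with neighboursX x | neighboursY y
    ... | M , adjM , injM | N , adjN , injN = K , adjK , injK
      where
      K : Fin 4 → Vertex (X □ Y)
      K zero                   = M zero , y
      K (suc zero)             = M (suc zero) , y
      K (suc (suc zero))       = x , N zero
      K (suc (suc (suc zero))) = x , N (suc zero)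

      adjK : ∀ i → Adj (X □ Y) (x , y) (K i)
      adjK zero                   = inj₂ (refl , adjM zero)
      adjK (suc zero)             = inj₂ (refl , adjM (suc zero))
      adjK (suc (suc zero))       = inj₁ (refl , adjN zero)
      adjK (suc (suc (suc zero))) = inj₁ (refl , adjN (suc zero))

      -- A coincidence would make `x` adjacent to itself.
      M≢N : ∀ {i j} {A : Set} → _≡_ {A = Vertex (X □ Y)} (M i , y) (x , N j) → A
      M≢N {i} eq = contradiction (subst (Adj X x) (cong proj₁ eq) (adjM i)) (adj-irrefl X)

      injK : Injective _≡_ _≡_ K
      injK {zero}                   {zero}                   _  = refl
      injK {zero}                   {suc zero}               eq = contradiction (injM (cong proj₁ eq)) λ ()
      injK {zero}                   {suc (suc zero)}         eq = M≢N eq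
      injK {zero}                   {suc (suc (suc zero))}   eq = M≢N eq
      injK {suc zero}               {zero}                   eq = contradiction (injM (cong proj₁ eq)) λ ()
      injK {suc zero}               {suc zero}               _  = refl
      injK {suc zero}               {suc (suc zero)}         eq = M≢N eq
      injK {suc zero}               {suc (suc (suc zero))}   eq = M≢N eq
      injK {suc (suc zero)}         {zero}                   eq = M≢N (sym eq)
      injK {suc (suc zero)}         {suc zero}               eq = M≢N (sym eq)
      injK {suc (suc zero)}         {suc (suc zero)}         _  = refl
      injK {suc (suc zero)}         {suc (suc (suc zero))}   eq = contradiction (injN (cong proj₂ eq)) λ ()
      injK {suc (suc (suc zero))}   {zero}                   eq = M≢N (sym eq)
      injK {suc (suc (suc zero))}   {suc zero}               eq = M≢N (sym eq)
      injK {suc (suc (suc zero))}   {suc (suc zero)}         eq = contradiction (injN (cong proj₂ eq)) λ ()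
      injK {suc (suc (suc zero))}   {suc (suc (suc zero))}   _  = refl

    -- Both differences `g - g′` and `h - h′` equal `f′ - f`; the additive form avoids subtraction.
    cross : ∀ f f′ g g′ h h′ → f + g ≡ f′ + g′ → f + h ≡ f′ + h′ → g + h′ ≡ g′ + h
    cross f f′ g g′ h h′ eq₁ eq₂ = +-cancelˡ-≡ (f + f′) _ _ (begin
      (f + f′) + (g + h′)  ≡⟨ solve 4 (λ a b c d → (a :+ b) :+ (c :+ d) := (a :+ c) :+ (b :+ d)) refl f f′ g h′ ⟩
      (f + g) + (f′ + h′)  ≡⟨ cong₂ _+_ eq₁ (sym eq₂) ⟩
      (f′ + g′) + (f + h)  ≡⟨ solve 4 (λ a b c d → (b :+ c) :+ (a :+ d) := (a :+ b) :+ (c :+ d)) refl f f′ g′ h ⟩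
      (f + f′) + (g′ + h)  ∎)
      where
      open ≡-Reasoning
      open +-*-Solver

    -- The landmarks over `a` share the summand from `X`, which cancels in differences and leaves
    -- the double resolution of `Y`. Once the second coordinates agree, the landmarks over `c`
    -- resolve the first.
    resolving-□ : ∀ {a b c d e} →
      (∀ x x′ → DX.dist a x ≡ DX.dist a x′ → DX.dist b x ≡ DX.dist b x′ → x ≡ x′) →
      (∀ y y′ → DY.dist c y + DY.dist d y′ ≡ DY.dist c y′ + DY.dist d y →
                DY.dist d y + DY.dist e y′ ≡ DY.dist d y′ + DY.dist e y → y ≡ y′) →
      a ≢ b → c ≢ d → c ≢ e → d ≢ e →
      IsResolving (X □ Y) ((a , c) ∷ (b , c) ∷ (a , d) ∷ (a , e) ∷ [])
    resolving-□ {a} {b} {c} {d} {e} resolveX doublyResolveY a≢b c≢d c≢e d≢e =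
      resolving distance-□
        (((λ eq → a≢b (cong proj₁ eq)) ∷ (λ eq → c≢d (cong proj₂ eq)) ∷ (λ eq → c≢e (cong proj₂ eq)) ∷ [])
         ∷ ((λ eq → c≢d (cong proj₂ eq)) ∷ (λ eq → c≢e (cong proj₂ eq)) ∷ [])
         ∷ ((λ eq → d≢e (cong proj₂ eq)) ∷ [])
         ∷ [] ∷ [])
        separates
      where
      separates : Separates distance-□ ((a , c) ∷ (b , c) ∷ (a , d) ∷ (a , e) ∷ [])
      separates (x , y) (x′ , y′) eq
        with eq₁ , tail₁ ← ∷-injective eq
        with eq₂ , tail₂ ← ∷-injective tail₁
        with eq₃ , tail₃ ← ∷-injective tail₂
        with eq₄ , _     ← ∷-injective tail₃
        with refl ← doublyResolveY y y′
               (cross (DX.dist a x) (DX.dist a x′) (DY.dist c y) _ (DY.dist d y) _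
                  (just-injective eq₁) (just-injective eq₃))
               (cross (DX.dist a x) (DX.dist a x′) (DY.dist d y) _ (DY.dist e y) _
                  (just-injective eq₃) (just-injective eq₄))
        = cong (_, y) (resolveX x x′
            (+-cancelʳ-≡ (DY.dist c y) _ _ (just-injective eq₁))
            (+-cancelʳ-≡ (DY.dist c y) _ _ (just-injective eq₂)))

-- Bishop moves on three rows

∣-∣≡⇒ : ∀ m n {k} → ∣ m - n ∣ ≡ k → n ≡ k + m ⊎ m ≡ k + n
∣-∣≡⇒ zero    n       refl = inj₁ (sym (+-identityʳ n))
∣-∣≡⇒ (suc m) zero    refl = inj₂ (cong suc (sym (+-identityʳ m)))
∣-∣≡⇒ (suc m) (suc n) {k} eq with ∣-∣≡⇒ m n eq
... | inj₁ n≡ = inj₁ (trans (cong suc n≡) (sym (+-suc k m)))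
... | inj₂ m≡ = inj₂ (trans (cong suc m≡) (sym (+-suc k n)))

∣m+n-n∣≡m : ∀ m n → ∣ m + n - n ∣ ≡ m
∣m+n-n∣≡m m n = trans (m≤n⇒∣n-m∣≡n∸m (m≤n+m n m)) (m+n∸n≡m m n)

parity-suc : ∀ n → parity (suc n) ≡ parity n ⁻¹
parity-suc n = sym (⁻¹-selfInverse (suc-homo-⁻¹ n))

parity-∣-∣ : ∀ m n → parity ∣ m - n ∣ ≡ parity m +ℙ parity n
parity-∣-∣ zero    n       = refl
parity-∣-∣ (suc m) zero    = p≡p+0 (parity (suc m))
  where
  p≡p+0 : ∀ p → p ≡ p +ℙ 0ℙ
  p≡p+0 0ℙ = refl
  p≡p+0 1ℙ = refl
parity-∣-∣ (suc m) (suc n) = begin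
  parity ∣ m - n ∣               ≡⟨ parity-∣-∣ m n ⟩
  parity m +ℙ parity n           ≡⟨ cancel (parity m) (parity n) ⟩
  parity m ⁻¹ +ℙ parity n ⁻¹     ≡⟨ cong₂ _+ℙ_ (parity-suc m) (parity-suc n) ⟨
  parity (suc m) +ℙ parity (suc n) ∎
  where
  open ≡-Reasoning
  cancel : ∀ p q → p +ℙ q ≡ p ⁻¹ +ℙ q ⁻¹
  cancel 0ℙ 0ℙ = refl
  cancel 0ℙ 1ℙ = refl
  cancel 1ℙ 0ℙ = refl
  cancel 1ℙ 1ℙ = refl

+ℙ-exchange : ∀ p q r s → p +ℙ q ≡ r +ℙ s → p +ℙ r ≡ q +ℙ s
+ℙ-exchange 0ℙ 0ℙ 0ℙ 0ℙ _  = refl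
+ℙ-exchange 0ℙ 0ℙ 1ℙ 1ℙ _  = refl
+ℙ-exchange 0ℙ 1ℙ 0ℙ 1ℙ _  = refl
+ℙ-exchange 0ℙ 1ℙ 1ℙ 0ℙ _  = refl
+ℙ-exchange 1ℙ 0ℙ 0ℙ 1ℙ _  = refl
+ℙ-exchange 1ℙ 0ℙ 1ℙ 0ℙ _  = refl
+ℙ-exchange 1ℙ 1ℙ 0ℙ 0ℙ _  = refl
+ℙ-exchange 1ℙ 1ℙ 1ℙ 1ℙ _  = refl
+ℙ-exchange 0ℙ 0ℙ 0ℙ 1ℙ ()
+ℙ-exchange 0ℙ 0ℙ 1ℙ 0ℙ ()
+ℙ-exchange 0ℙ 1ℙ 0ℙ 0ℙ ()
+ℙ-exchange 0ℙ 1ℙ 1ℙ 1ℙ ()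
+ℙ-exchange 1ℙ 0ℙ 0ℙ 0ℙ ()
+ℙ-exchange 1ℙ 0ℙ 1ℙ 1ℙ ()
+ℙ-exchange 1ℙ 1ℙ 0ℙ 1ℙ ()
+ℙ-exchange 1ℙ 1ℙ 1ℙ 0ℙ ()

-- With `a`, `b` as rows and `c`, `d` as columns, this is why a bishop keeps its colour.
parity-exchange : ∀ a b c d → parity ∣ a - b ∣ ≡ parity ∣ c - d ∣ →
                  parity (a + c) ≡ parity (b + d)
parity-exchange a b c d eq = begin
  parity (a + c)        ≡⟨ +-homo-+ a c ⟩
  parity a +ℙ parity c  ≡⟨ +ℙ-exchange (parity a) (parity b) _ _
                             (trans (sym (parity-∣-∣ a b)) (trans eq (parity-∣-∣ c d))) ⟩
  parity b +ℙ parity d  ≡⟨ +-homo-+ b d ⟨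
  parity (b + d)        ∎
  where open ≡-Reasoning

-- A move by two columns swaps the outer rows, so a bishop on the outer rows
-- that avoids the middle row stays on one of two rails; on the middle row,
-- which belongs to neither rail, it can change rails.
Rail : Set
Rail = Maybe Parity

-- Two columns further `⌊ j /2⌋` has grown by one, which the extra `suc` on row 2 offsets; so a move
-- between the outer rows keeps the label.
railAt : Fin 3 → ℕ → Rail
railAt zero             j = just (parity ⌊ j /2⌋)
railAt (suc zero)       j = nothing
railAt (suc (suc zero)) j = just (parity (suc ⌊ j /2⌋))

railAt-injective : ∀ i i′ j → railAt i j ≡ railAt i′ j → i ≡ i′
railAt-injective zero             zero             _ _  = refl
railAt-injective zero             (suc (suc zero)) j eq =
  contradiction (trans (just-injective eq) (parity-suc ⌊ j /2⌋)) (p≢p⁻¹ _)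
railAt-injective (suc zero)       (suc zero)       _ _  = refl
railAt-injective (suc (suc zero)) zero             j eq =
  contradiction (trans (sym (just-injective eq)) (parity-suc ⌊ j /2⌋)) (p≢p⁻¹ _)
railAt-injective (suc (suc zero)) (suc (suc zero)) _ _  = refl
railAt-injective zero             (suc zero)       _ ()
railAt-injective (suc zero)       zero             _ ()
railAt-injective (suc zero)       (suc (suc zero)) _ ()
railAt-injective (suc (suc zero)) (suc zero)       _ ()

-- The moves as the rails see them; the last index counts the columns crossed.
data Step : Rail → Rail → ℕ → Set where
  along : ∀ {ρ} → Step (just ρ) (just ρ) 2
  off   : ∀ {ρ} → Step (just ρ) nothing 1
  on    : ∀ {ρ} → Step nothing (just ρ) 1

-- The parity of the row index, recovered from the rail.
side : Rail → Parity
side nothing  = 1ℙ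
side (just _) = 0ℙ

same-rail : ∀ {ρ σ δ} → Step (just ρ) (just σ) δ → just σ ≡ just ρ
same-rail along = refl

rowOn : Parity → ℕ → Fin 3
rowOn σ j with parity ⌊ j /2⌋ ≟ℙ σ
... | yes _ = zero
... | no  _ = suc (suc zero)

railAt-rowOn : ∀ σ j → railAt (rowOn σ j) j ≡ just σ
railAt-rowOn σ j with parity ⌊ j /2⌋ ≟ℙ σ
... | yes eq = cong just eq
... | no ≢σ  = cong just (trans (parity-suc ⌊ j /2⌋) (other _ σ ≢σ))
  where
  other : ∀ p q → p ≢ q → p ⁻¹ ≡ q
  other 0ℙ 0ℙ ≢ = contradiction refl ≢
  other 0ℙ 1ℙ _ = refl
  other 1ℙ 0ℙ _ = refl
  other 1ℙ 1ℙ ≢ = contradiction refl ≢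

rowOn-outer : ∀ σ j → ∣ 1 - toℕ (rowOn σ j) ∣ ≡ 1
rowOn-outer σ j with parity ⌊ j /2⌋ ≟ℙ σ
... | yes _ = refl
... | no  _ = refl

-- Distance formulas in terms of rails and column gap

near far mixed apart : ℕ → ℕ
near D          = ⌊ D /2⌋
far D           = 2 ⊔ suc ⌊ D /2⌋
mixed D         = 1 ⊔ ⌈ D /2⌉
apart zero      = 0
apart D@(suc _) = suc ⌊ D /2⌋

-- Moves along a rail cross two columns, all others one. Changing rails takes a visit to the middle
-- row, hence at least two moves; travel between distinct middle squares begins and ends with a
-- one-column move. The maxima in `far` and `mixed` settle small gaps so that `hops-step` holds for
-- gaps of either parity.
hops : Rail → Rail → ℕ → ℕ
hops nothing   nothing   = apart
hops nothing   (just _)  = mixed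
hops (just _)  nothing   = mixed
hops (just 0ℙ) (just 0ℙ) = near
hops (just 0ℙ) (just 1ℙ) = far
hops (just 1ℙ) (just 0ℙ) = far
hops (just 1ℙ) (just 1ℙ) = near

hops-same : ∀ ρ D → hops (just ρ) (just ρ) D ≡ near D
hops-same 0ℙ D = refl
hops-same 1ℙ D = refl

hops-other : ∀ {ρ σ} → ρ ≢ σ → ∀ D → hops (just ρ) (just σ) D ≡ far D
hops-other {0ℙ} {0ℙ} ≢ D = contradiction refl ≢
hops-other {0ℙ} {1ℙ} ≢ D = refl
hops-other {1ℙ} {0ℙ} ≢ D = refl
hops-other {1ℙ} {1ℙ} ≢ D = contradiction refl ≢

hops-refl : ∀ r → hops r r 0 ≡ 0
hops-refl nothing   = refl
hops-refl (just 0ℙ) = refl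
hops-refl (just 1ℙ) = refl

near-step : ∀ {D D′} → D ≤ 2 + D′ → near D ≤ suc (near D′)
near-step = ⌊n/2⌋-mono

far-step : ∀ {D D′} → D ≤ 2 + D′ → far D ≤ suc (far D′)
far-step {D′ = D′} D≤ = s≤s (⊔-lub (s≤s z≤n) (≤-trans (⌊n/2⌋-mono D≤) (m≤n⊔m 2 (suc (near D′)))))

far-off-step : ∀ {D D′} → D ≤ 1 + D′ → far D ≤ suc (mixed D′)
far-off-step D≤ = s≤s (⊔-monoʳ-≤ 1 (⌊n/2⌋-mono D≤))

near-off-step : ∀ {D D′} → D ≤ 1 + D′ → near D ≤ suc (mixed D′)
near-off-step D≤ = ≤-trans (⌊n/2⌋-mono D≤) (m≤n⇒m≤1+n (m≤n⊔m 1 _))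

mixed-step : ∀ {D D′} → D ≤ 2 + D′ → mixed D ≤ suc (mixed D′)
mixed-step D≤ = ⊔-lub (s≤s z≤n) (≤-trans (⌈n/2⌉-mono D≤) (s≤s (m≤n⊔m 1 _)))

mixed-on-near-step : ∀ {D D′} → D ≤ 1 + D′ → mixed D ≤ suc (near D′)
mixed-on-near-step D≤ = ⊔-lub (s≤s z≤n) (⌈n/2⌉-mono D≤)

mixed-on-far-step : ∀ {D D′} → D ≤ 1 + D′ → mixed D ≤ suc (far D′)
mixed-on-far-step D≤ =
  ≤-trans (mixed-on-near-step D≤) (s≤s (≤-trans (n≤1+n _) (m≤n⊔m 2 _)))

mixed-off-step : ∀ {D D′} → D ≤ 1 + D′ → mixed D ≤ suc (apart D′)
mixed-off-step {D′ = zero}  D≤ = ⊔-lub ≤-refl (⌈n/2⌉-mono D≤)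
mixed-off-step {D′ = suc _} D≤ =
  ⊔-lub (s≤s z≤n) (m≤n⇒m≤1+n (⌈n/2⌉-mono D≤))

apart-on-step : ∀ {D D′} → D ≤ 1 + D′ → apart D ≤ suc (mixed D′)
apart-on-step {zero}  _  = z≤n
apart-on-step {suc _} D≤ = s≤s (≤-trans (⌊n/2⌋-mono D≤) (m≤n⊔m 1 _))

-- The lower bound on walk lengths, one move at a time; the hypothesis on the gaps is what the
-- triangle inequality for columns supplies.
hops-step : ∀ {r r′ δ} s {D D′} → Step r r′ δ → D ≤ δ + D′ → hops r s D ≤ suc (hops r′ s D′)
hops-step nothing   (along {ρ})  = mixed-step
hops-step (just 0ℙ) (along {0ℙ}) = near-step
hops-step (just 0ℙ) (along {1ℙ}) = far-step
hops-step (just 1ℙ) (along {0ℙ}) = far-step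
hops-step (just 1ℙ) (along {1ℙ}) = near-step
hops-step nothing   (off {ρ})    = mixed-off-step
hops-step (just 0ℙ) (off {0ℙ})   = near-off-step
hops-step (just 0ℙ) (off {1ℙ})   = far-off-step
hops-step (just 1ℙ) (off {0ℙ})   = far-off-step
hops-step (just 1ℙ) (off {1ℙ})   = near-off-step
hops-step nothing   (on {ρ})     = apart-on-step
hops-step (just 0ℙ) (on {0ℙ})    = mixed-on-near-step
hops-step (just 0ℙ) (on {1ℙ})    = mixed-on-far-step
hops-step (just 1ℙ) (on {0ℙ})    = mixed-on-far-step
hops-step (just 1ℙ) (on {1ℙ})    = mixed-on-near-step

apart-mono : ∀ {D D′} → D ≤ D′ → apart D ≤ apart D′
apart-mono z≤n        = z≤n
apart-mono D≤@(s≤s _) = s≤s (⌊n/2⌋-mono D≤)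

hops-mono : ∀ r s {D D′} → D ≤ D′ → hops r s D ≤ hops r s D′
hops-mono nothing   nothing   = apart-mono
hops-mono nothing   (just σ)  = ⊔-monoʳ-≤ 1 ∘ ⌈n/2⌉-mono
hops-mono (just ρ)  nothing   = ⊔-monoʳ-≤ 1 ∘ ⌈n/2⌉-mono
hops-mono (just 0ℙ) (just 0ℙ) = ⌊n/2⌋-mono
hops-mono (just 0ℙ) (just 1ℙ) = ⊔-monoʳ-≤ 2 ∘ s≤s ∘ ⌊n/2⌋-mono
hops-mono (just 1ℙ) (just 0ℙ) = ⊔-monoʳ-≤ 2 ∘ s≤s ∘ ⌊n/2⌋-mono
hops-mono (just 1ℙ) (just 1ℙ) = ⌊n/2⌋-mono

-- Growth of the distances with the gap

parity-gap : ∀ {m n} → parity m ≡ parity n → m < n → 2 + m ≤ n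
parity-gap {m} m~n m<n with m≤n⇒m<n∨m≡n m<n
... | inj₁ gap  = gap
... | inj₂ refl = contradiction (trans m~n (parity-suc m)) (p≢p⁻¹ _)

near-strict : ∀ {D D′} → parity D ≡ parity D′ → D < D′ → near D < near D′
near-strict D~D′ D<D′ = ⌊n/2⌋-mono (parity-gap D~D′ D<D′)

-- Oddness excludes the gap 0, where `mixed` takes the default value 1 and ties with its value at 2.
mixed-strict : ∀ {D D′} → parity D ≡ 1ℙ → parity D ≡ parity D′ → D < D′ → mixed D < mixed D′
mixed-strict {suc _} _ D~D′ D<D′ =
  ≤-trans (⌈n/2⌉-mono (parity-gap D~D′ D<D′)) (m≤n⊔m 1 _)

apart-strict : ∀ {D D′} → parity D ≡ parity D′ → D < D′ → apart D < apart D′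
apart-strict {zero}  {suc _} D~D′ D<D′ = s≤s z≤n
apart-strict {suc _} {suc _} D~D′ D<D′ = s≤s (near-strict D~D′ D<D′)

-- Opposite rails are left out: `far` has the value 2 at both gaps 0 and 2, so it is not strict.
data Compatible : Rail → Rail → Set where
  same   : ∀ {r} → Compatible r r
  middle : ∀ {r} → Compatible nothing r
  centre : ∀ {r} → Compatible r nothing

hops-strict : ∀ {r s D D′} → Compatible r s → parity D ≡ side r +ℙ side s →
              parity D ≡ parity D′ → D < D′ → hops r s D < hops r s D′
hops-strict {nothing} {nothing}  _    _   = apart-strict
hops-strict {nothing} {just _}   _    odd = mixed-strict odd
hops-strict {just _}  {nothing}  _    odd = mixed-strict odd
hops-strict {just 0ℙ} {just 0ℙ}  same _   = near-strict
hops-strict {just 1ℙ} {just 1ℙ}  same _   = near-strict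

near<far : ∀ D → near D < far D
near<far D = m≤n⊔m 2 _

<-swap : ∀ {a b c d} → a < b → c ≤ d → a + c ≢ d + b
<-swap {b = b} {d = d} a<b c≤d eq = <⇒≢ (+-mono-<-≤ a<b c≤d) (trans eq (+-comm d b))

≤-swap : ∀ {a b c d} → a ≤ b → c < d → a + c ≢ d + b
≤-swap {b = b} {d = d} a≤b c<d eq = <⇒≢ (+-mono-≤-< a≤b c<d) (trans eq (+-comm d b))

-- The distance from rail `ρ` minus the distance from the other rail, at a common gap, is negative
-- for targets on `ρ`, zero on the middle row and positive on the other rail. Its sign therefore
-- reveals the rail.
twins-separate : ∀ ρ r s D D′ →
  hops (just ρ) r D + hops (just (ρ ⁻¹)) s D′ ≡ hops (just ρ) s D′ + hops (just (ρ ⁻¹)) r D →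
  r ≡ s
twins-separate 0ℙ = go
  where
  go : ∀ r s D D′ →
       hops (just 0ℙ) r D + hops (just 1ℙ) s D′ ≡ hops (just 0ℙ) s D′ + hops (just 1ℙ) r D →
       r ≡ s
  go nothing   nothing   D D′ _  = refl
  go (just 0ℙ) (just 0ℙ) D D′ _  = refl
  go (just 1ℙ) (just 1ℙ) D D′ _  = refl
  go (just 0ℙ) (just 1ℙ) D D′ eq =
    contradiction eq (<-swap (near<far D) (<⇒≤ (near<far D′)))
  go (just 1ℙ) (just 0ℙ) D D′ eq =
    contradiction (sym eq) (<-swap (near<far D′) (<⇒≤ (near<far D)))
  go (just 0ℙ) nothing   D D′ eq =
    contradiction eq (<-swap (near<far D) (≤-refl {mixed D′}))
  go (just 1ℙ) nothing   D D′ eq =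
    contradiction (sym eq) (≤-swap (≤-refl {mixed D′}) (near<far D))
  go nothing   (just 0ℙ) D D′ eq =
    contradiction (sym eq) (<-swap (near<far D′) (≤-refl {mixed D}))
  go nothing   (just 1ℙ) D D′ eq =
    contradiction eq (≤-swap (≤-refl {mixed D}) (near<far D′))
twins-separate 1ℙ r s D D′ eq = twins-separate 0ℙ r s D D′
  (trans (+-comm (hops (just 0ℙ) r D) _)
    (trans (sym eq) (+-comm (hops (just 1ℙ) r D) _)))


-- Vertices of one colour

-- The bound by `j ⊔ k` keeps the intermediate column on the board.
toward : ∀ j k s → s ≤ ∣ j - k ∣ →
         ∃[ i ] (i ≤ j ⊔ k × ∣ j - i ∣ ≡ s × s + ∣ i - k ∣ ≡ ∣ j - k ∣)
toward zero    k       s s≤ = s , s≤ , refl , trans (cong (s +_) (m≤n⇒∣m-n∣≡n∸m s≤)) (m+[n∸m]≡n s≤)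
toward (suc j) zero    s s≤ =
  suc j ∸ s , m∸n≤m (suc j) s ,
  trans (m≤n⇒∣n-m∣≡n∸m (m∸n≤m (suc j) s)) (m∸[m∸n]≡n s≤) ,
  trans (cong (s +_) (∣-∣-identityʳ (suc j ∸ s))) (m+[n∸m]≡n s≤)
toward (suc j) (suc k) s s≤ with toward j k s s≤
... | i , i≤ , ji , eq = suc i , s≤s i≤ , ji , eq

module Colour (m : ℕ) (p : Parity) where

  n : ℕ
  n = 3 + m

  G : SimpleGraph
  G = induced (bishop 3 n) (λ s → colour s ≡ p)

  V : Set
  V = Vertex G

  row : V → Fin 3
  row v = proj₁ (value v)

  column : V → Fin n
  column v = proj₂ (value v)

  col : V → ℕ
  col v = toℕ (column v)

  rail : V → Rail
  rail v = railAt (row v) (col v)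

  gap : V → V → ℕ
  gap v w = ∣ col v - col w ∣

  hopDist : V → V → ℕ
  hopDist v w = hops (rail v) (rail w) (gap v w)

  colour-≡ : ∀ v → parity (toℕ (row v) + col v) ≡ p
  colour-≡ (_ , [ q ]) = recompute (_ ≟ℙ p) q

  position : ∀ {v w} → rail v ≡ rail w → col v ≡ col w → v ≡ w
  position {v} {w} r≡ c≡ = value-injective (cong₂ _,_
    (railAt-injective (row v) (row w) (col v)
      (trans r≡ (cong (railAt (row w)) (sym c≡))))
    (toℕ-injective c≡))

  -- Within one colour the parity of the row fixes that of the column.
  parity-gap-sides : ∀ v w → parity (gap v w) ≡ side (rail v) +ℙ side (rail w)
  parity-gap-sides v w = begin
    parity (gap v w)
      ≡⟨ parity-∣-∣ (col v) (col w) ⟩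
    parity (col v) +ℙ parity (col w)
      ≡⟨ +ℙ-exchange (parity (toℕ (row v))) _ _ _ (trans (sum-≡ v) (sym (sum-≡ w))) ⟨
    parity (toℕ (row v)) +ℙ parity (toℕ (row w))
      ≡⟨ cong₂ _+ℙ_ (parity-row (row v) (col v)) (parity-row (row w) (col w)) ⟩
    side (rail v) +ℙ side (rail w)
      ∎
    where
    open ≡-Reasoning
    sum-≡ : ∀ v → parity (toℕ (row v)) +ℙ parity (col v) ≡ p
    sum-≡ v = trans (sym (+-homo-+ (toℕ (row v)) (col v))) (colour-≡ v)
    parity-row : ∀ i j → parity (toℕ i) ≡ side (railAt i j)
    parity-row zero             _ = refl
    parity-row (suc zero)       _ = refl
    parity-row (suc (suc zero)) _ = refl

  -- Hop counts are the distances

  adj⇒step : ∀ v w → Adj G v w → Step (rail v) (rail w) (gap v w)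
  adj⇒step v w (v≢w , eq) = steps (row v) (row w) (col v) (col w) distinct eq
    where
    distinct : row v ≡ row w → col v ≢ col w
    distinct r≡ c≡ = v≢w (cong₂ _,_ r≡ (toℕ-injective c≡))

    steps : ∀ i i′ j j′ → (i ≡ i′ → j ≢ j′) → ∣ toℕ i - toℕ i′ ∣ ≡ ∣ j - j′ ∣ →
            Step (railAt i j) (railAt i′ j′) ∣ j - j′ ∣
    steps zero             zero             j j′ ≢ eq =
      contradiction (∣m-n∣≡0⇒m≡n (sym eq)) (≢ refl)
    steps zero             (suc zero)       j j′ ≢ eq = subst (Step _ _) eq off
    -- Writing one column as the other plus two makes both rail labels compute to the same parity.
    steps zero             (suc (suc zero)) j j′ ≢ eq with ∣-∣≡⇒ j j′ (sym eq)
    ... | inj₁ refl = subst (Step _ _) eq along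
    ... | inj₂ refl = subst (Step _ _) eq along
    steps (suc zero)       zero             j j′ ≢ eq = subst (Step _ _) eq on
    steps (suc zero)       (suc zero)       j j′ ≢ eq =
      contradiction (∣m-n∣≡0⇒m≡n (sym eq)) (≢ refl)
    steps (suc zero)       (suc (suc zero)) j j′ ≢ eq = subst (Step _ _) eq on
    steps (suc (suc zero)) zero             j j′ ≢ eq with ∣-∣≡⇒ j j′ (sym eq)
    ... | inj₁ refl = subst (Step _ _) eq along
    ... | inj₂ refl = subst (Step _ _) eq along
    steps (suc (suc zero)) (suc zero)       j j′ ≢ eq = subst (Step _ _) eq off
    steps (suc (suc zero)) (suc (suc zero)) j j′ ≢ eq =
      contradiction (∣m-n∣≡0⇒m≡n (sym eq)) (≢ refl)

  hopDist-≤ : ∀ {v w m} → Walk G v w m → hopDist v w ≤ m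
  hopDist-≤ {v} [] = ≤-reflexive
    (trans (cong (hops (rail v) (rail v)) (∣n-n∣≡0 (col v))) (hops-refl (rail v)))
  hopDist-≤ {v} {w} (_∷_ {v = u} e p) = ≤-trans
    (hops-step (rail w) (adj⇒step v u e) (∣-∣-triangle (col v) (col u) (col w)))
    (s≤s (hopDist-≤ p))

  Move : V → Fin 3 → Fin n → Set
  Move v i j = Σ[ v′ ∈ V ] (Adj G v v′ × row v′ ≡ i × column v′ ≡ j)

  -- The displacement has the form `suc k` so that the target differs from `v`.
  move : ∀ v i j {k} → ∣ col v - toℕ j ∣ ≡ suc k → ∣ toℕ (row v) - toℕ i ∣ ≡ suc k → Move v i j
  move v i j ∣j∣ ∣i∣ =
    ((i , j) , [ trans (sym (parity-exchange (toℕ (row v)) (toℕ i) (col v) (toℕ j) (cong parity eq))) (colour-≡ v) ]) ,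
    ((λ v≡ → contradiction
        (trans (sym ∣j∣) (m≡n⇒∣m-n∣≡0 (cong (toℕ ∘ proj₂) v≡))) λ ()) ,
     eq) ,
    refl , refl
    where
    eq : ∣ toℕ (row v) - toℕ i ∣ ≡ ∣ col v - toℕ j ∣
    eq = trans ∣i∣ (sym ∣j∣)

  NeighbourAt : V → Rail → Fin n → Set
  NeighbourAt v r j = Σ[ v′ ∈ V ] (Adj G v v′ × rail v′ ≡ r × column v′ ≡ j)

  off-rail : ∀ v j {ρ} → rail v ≡ just ρ → ∣ col v - toℕ j ∣ ≡ 1 → NeighbourAt v nothing j
  off-rail v@((zero , _) , _)           j _  ∣j∣ with move v (suc zero) j ∣j∣ refl
  ... | v′ , e , refl , refl = v′ , e , refl , refl
  off-rail v@((suc (suc zero) , _) , _) j _  ∣j∣ with move v (suc zero) j ∣j∣ refl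
  ... | v′ , e , refl , refl = v′ , e , refl , refl
  off-rail   ((suc zero , _) , _)       j () ∣j∣

  onto-rail : ∀ v j σ → rail v ≡ nothing → ∣ col v - toℕ j ∣ ≡ 1 → NeighbourAt v (just σ) j
  onto-rail v@((suc zero , _) , _)     j σ _ ∣j∣
    with move v (rowOn σ (toℕ j)) j ∣j∣ (rowOn-outer σ (toℕ j))
  ... | v′ , e , refl , refl = v′ , e , railAt-rowOn σ (toℕ j) , refl
  onto-rail ((zero , _) , _)           j σ () ∣j∣
  onto-rail ((suc (suc zero) , _) , _) j σ () ∣j∣

  along-rail : ∀ v j {ρ} → rail v ≡ just ρ → ∣ col v - toℕ j ∣ ≡ 2 → NeighbourAt v (just ρ) j
  along-rail v@((zero , _) , _)           j r≡ ∣j∣ with move v (suc (suc zero)) j ∣j∣ refl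
  ... | v′ , e , refl , refl = v′ , e , trans (same-rail (adj⇒step v v′ e)) r≡ , refl
  along-rail v@((suc (suc zero) , _) , _) j r≡ ∣j∣ with move v zero j ∣j∣ refl
  ... | v′ , e , refl , refl = v′ , e , trans (same-rail (adj⇒step v v′ e)) r≡ , refl
  along-rail   ((suc zero , _) , _)       j () ∣j∣

  stepColumn : ∀ v w s → s ≤ gap v w →
               Σ[ j ∈ Fin n ] (∣ col v - toℕ j ∣ ≡ s × s + ∣ toℕ j - col w ∣ ≡ gap v w)
  stepColumn v w s s≤ with toward (col v) (col w) s s≤
  ... | i , i≤ , ∣i∣ , rest =
    fromℕ< i<n , subst (λ i → ∣ col v - i ∣ ≡ s × s + ∣ i - col w ∣ ≡ gap v w)
                       (sym (toℕ-fromℕ< i<n)) (∣i∣ , rest)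
    where
    i<n : i < n
    i<n = ≤-<-trans i≤ (⊔-lub (toℕ<n (column v)) (toℕ<n (column w)))

  beside : (j : Fin n) → Σ[ i ∈ Fin n ] ∣ toℕ j - toℕ i ∣ ≡ 1
  beside zero    = suc zero , refl
  beside (suc j) = inject₁ j ,
    trans (cong ∣ suc (toℕ j) -_∣ (toℕ-inject₁ j)) (∣m+n-n∣≡m 1 (toℕ j))

  Descent : V → V → Set
  Descent v w = Σ[ v′ ∈ V ] (Adj G v v′ × hopDist v′ w < hopDist v w)

  descent : ∀ v w {r r′ s j D D′} → rail v ≡ r → rail w ≡ s → gap v w ≡ D →
            NeighbourAt v r′ j → ∣ toℕ j - col w ∣ ≡ D′ → hops r′ s D′ < hops r s D →
            Descent v w
  descent v w refl refl refl (v′ , e , refl , refl) refl lt = v′ , e , lt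

  -- A greedy move: along the rail if `w` is on the same one, or on the middle row more than one
  -- column away; otherwise onto or off a rail. Gaps of the wrong parity cannot occur.
  descend : ∀ v w → v ≢ w → Descent v w
  descend v w v≢w = go (rail v) (rail w) (gap v w) refl refl refl (parity-gap-sides v w)
    where
    closer : ∀ s {D} → gap v w ≡ s + D →
             Σ[ j ∈ Fin n ] (∣ col v - toℕ j ∣ ≡ s × ∣ toℕ j - col w ∣ ≡ D)
    closer s {D} g≡ with stepColumn v w s (≤-trans (m≤m+n s D) (≤-reflexive (sym g≡)))
    ... | j , ∣j∣ , rest = j , ∣j∣ , +-cancelˡ-≡ s _ _ (trans rest g≡)

    go : ∀ r s D → rail v ≡ r → rail w ≡ s → gap v w ≡ D → parity D ≡ side r +ℙ side s →
         Descent v w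
    go nothing  nothing  0 r≡ s≡ g≡ _ =
      contradiction (position {v} {w} (trans r≡ (sym s≡)) (∣m-n∣≡0⇒m≡n g≡)) v≢w
    go nothing  nothing  1 _  _  _  ()
    go nothing  nothing  (suc (suc D)) r≡ s≡ g≡ _ with closer 1 g≡
    -- The choice of `0ℙ` is arbitrary: `mixed` measures the way back to the middle row from either
    -- rail.
    ... | j , ∣j∣ , rest = descent v w r≡ s≡ g≡ (onto-rail v j 0ℙ r≡ ∣j∣) rest ≤-refl
    go nothing  (just σ) 0 _  _  _  ()
    go nothing  (just σ) (suc D) r≡ s≡ g≡ _ with closer 1 g≡
    ... | j , ∣j∣ , rest = descent v w r≡ s≡ g≡ (onto-rail v j σ r≡ ∣j∣) rest
      (≤-reflexive (cong suc (hops-same σ D)))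
    go (just ρ) nothing  0 _  _  _  ()
    go (just ρ) nothing  1 r≡ s≡ g≡ _ with closer 1 g≡
    ... | j , ∣j∣ , rest = descent v w r≡ s≡ g≡ (off-rail v j r≡ ∣j∣) rest ≤-refl
    go (just ρ) nothing  2 _  _  _  ()
    go (just ρ) nothing  (suc (suc (suc D))) r≡ s≡ g≡ _ with closer 2 g≡
    ... | j , ∣j∣ , rest = descent v w r≡ s≡ g≡ (along-rail v j r≡ ∣j∣) rest ≤-refl
    go (just ρ) (just σ) D r≡ s≡ g≡ even with ρ ≟ℙ σ
    go (just ρ) (just ρ) 0 r≡ s≡ g≡ _ | yes refl =
      contradiction (position {v} {w} (trans r≡ (sym s≡)) (∣m-n∣≡0⇒m≡n g≡)) v≢w
    go (just ρ) (just ρ) (suc (suc D)) r≡ s≡ g≡ _ | yes refl with closer 2 g≡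
    ... | j , ∣j∣ , rest = descent v w r≡ s≡ g≡ (along-rail v j r≡ ∣j∣) rest
      (≤-reflexive (trans (cong suc (hops-same ρ D)) (sym (hops-same ρ (2 + D)))))
    -- The two outer squares of one column: the way leads over the middle square of a neighbouring
    -- column.
    go (just ρ) (just σ) 0 r≡ s≡ g≡ _ | no ρ≢σ with beside (column v)
    ... | j , ∣j∣ = descent v w r≡ s≡ g≡ (off-rail v j r≡ ∣j∣)
      (trans (∣-∣-comm (toℕ j) (col w))
        (trans (cong ∣_- toℕ j ∣ (sym (∣m-n∣≡0⇒m≡n {col v} {col w} g≡))) ∣j∣))
      (≤-reflexive (sym (hops-other ρ≢σ 0)))
    go (just ρ) (just σ) (suc D) r≡ s≡ g≡ _ | no ρ≢σ with closer 1 g≡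
    ... | j , ∣j∣ , rest = descent v w r≡ s≡ g≡ (off-rail v j r≡ ∣j∣) rest
      (≤-reflexive (sym (hops-other ρ≢σ (suc D))))

  _≟ᵛ_ : DecidableEquality V
  _≟ᵛ_ = ≟-refinement (≡-dec _≟ᶠ_ _≟ᶠ_)

  search-V : Searchable V
  search-V = search-refinement (search-× search-Fin search-Fin) (λ s → colour s ≟ℙ p)

  -- The bound `k` is the fuel of the recursion; each descent spends one unit.
  short-walk : ∀ v w k → hopDist v w ≤ k → Σ[ l ∈ ℕ ] (Walk G v w l × l ≤ k)
  short-walk v w k d≤k with v ≟ᵛ w
  ... | yes refl = 0 , [] , z≤n
  ... | no v≢w with k | descend v w v≢w
  ...   | zero   | _ , _ , lt = contradiction (≤-trans lt d≤k) λ ()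
  ...   | suc k′ | v′ , e , lt with short-walk v′ w k′ (≤-pred (≤-trans lt d≤k))
  ...     | l , walk , l≤ = suc l , e ∷ walk , s≤s l≤

  distance : DistanceFunction G
  distance = record
    { dist       = hopDist
    ; isDistance = λ v w → shortest v w , λ _ → hopDist-≤
    }
    where
    shortest : ∀ v w → Walk G v w (hopDist v w)
    shortest v w with short-walk v w (hopDist v w) ≤-refl
    ... | l , walk , l≤ = subst (Walk G v w) (≤-antisym l≤ (hopDist-≤ walk)) walk

  -- A middle square reaches both rails in an adjacent column. An outer square moves once along its
  -- rail and once off it, except in column 1, where three columns may leave no room for a move
  -- along; there it moves off to either side.
  neighbours : ∀ v → Neighbours G 2 v
  neighbours v = go (rail v) refl
    where
    two : ∀ v₁ v₂ → Adj G v v₁ → Adj G v v₂ → v₁ ≢ v₂ → Neighbours G 2 v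
    two v₁ v₂ e₁ e₂ v₁≢v₂ = N , adj , inj
      where
      N : Fin 2 → V
      N zero       = v₁
      N (suc zero) = v₂
      adj : ∀ i → Adj G v (N i)
      adj zero       = e₁
      adj (suc zero) = e₂
      inj : Injective _≡_ _≡_ N
      inj {zero}     {zero}     _  = refl
      inj {zero}     {suc zero} eq = contradiction eq v₁≢v₂
      inj {suc zero} {zero}     eq = contradiction (sym eq) v₁≢v₂
      inj {suc zero} {suc zero} _  = refl

    two-away : (j : Fin n) → (Σ[ i ∈ Fin n ] ∣ toℕ j - toℕ i ∣ ≡ 2) ⊎ j ≡ suc zero
    two-away zero          = inj₁ (suc (suc zero) , refl)
    two-away (suc zero)    = inj₂ refl
    two-away (suc (suc j)) = inj₁ (inject₁ (inject₁ j) ,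
      trans (cong ∣ 2 + toℕ j -_∣ (trans (toℕ-inject₁ (inject₁ j)) (toℕ-inject₁ j)))
            (∣m+n-n∣≡m 2 (toℕ j)))

    go : ∀ r → rail v ≡ r → Neighbours G 2 v
    go nothing r≡ with beside (column v)
    ... | j , ∣j∣ with onto-rail v j 0ℙ r≡ ∣j∣ | onto-rail v j 1ℙ r≡ ∣j∣
    ...   | v₁ , e₁ , r₁ , _ | v₂ , e₂ , r₂ , _ =
      two v₁ v₂ e₁ e₂ λ eq → contradiction (trans (sym r₁) (trans (cong rail eq) r₂)) λ ()
    go (just ρ) r≡ with two-away (column v)
    ... | inj₁ (i , ∣i∣) with beside (column v)
    ...   | j , ∣j∣ with along-rail v i r≡ ∣i∣ | off-rail v j r≡ ∣j∣
    ...     | v₁ , e₁ , r₁ , _ | v₂ , e₂ , r₂ , _ =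
      two v₁ v₂ e₁ e₂ λ eq → contradiction (trans (sym r₁) (trans (cong rail eq) r₂)) λ ()
    go (just ρ) r≡ | inj₂ c≡
      with off-rail v zero r≡ (cong (λ j → ∣ toℕ j - 0 ∣) c≡)
         | off-rail v (suc (suc zero)) r≡ (cong (λ j → ∣ toℕ j - 2 ∣) c≡)
    ... | v₁ , e₁ , _ , c₁ | v₂ , e₂ , _ , c₂ =
      two v₁ v₂ e₁ e₂ λ eq → contradiction (trans (sym c₁) (trans (cong column eq) c₂)) λ ()

  hopDist-strict : ∀ u v w → Compatible (rail u) (rail v) → rail v ≡ rail w →
                   gap u v < gap u w → hopDist u v < hopDist u w
  hopDist-strict u v w compatible r≡ lt =
    subst (λ r → hopDist u v < hops (rail u) r (gap u w)) r≡
      (hops-strict compatible (parity-gap-sides u v)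
        (trans (parity-gap-sides u v)
          (trans (cong (λ r → side (rail u) +ℙ side r) r≡) (sym (parity-gap-sides u w))))
        lt)

  hopDist-mono : ∀ u v w → rail v ≡ rail w → gap u v ≤ gap u w → hopDist u v ≤ hopDist u w
  hopDist-mono u v w r≡ le =
    subst (λ r → hopDist u v ≤ hops (rail u) r (gap u w)) r≡
      (hops-mono (rail u) (rail v) le)

  position-by-order : ∀ v w → rail v ≡ rail w → ¬ col v < col w → ¬ col w < col v → v ≡ w
  position-by-order v w r≡ v≮w w≮v =
    position {v} {w} r≡ (≤-antisym (≮⇒≥ w≮v) (≮⇒≥ v≮w))

  -- The two outer squares of a column

  module Twins (j : Fin n) (j∈p : parity (toℕ j) ≡ p) where

    top bottom : V
    top    = (zero , j) , [ j∈p ]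
    bottom = (suc (suc zero) , j) , [ j∈p ]

    top≢bottom : top ≢ bottom
    top≢bottom ()

    same-rails : ∀ v w → hopDist top v + hopDist bottom w ≡ hopDist top w + hopDist bottom v →
                 rail v ≡ rail w
    same-rails v w eq = twins-separate (parity ⌊ toℕ j /2⌋) (rail v) (rail w) (gap top v) (gap top w)
      (subst (λ ρ → hopDist top v + hops (just ρ) (rail w) (gap top w)
                  ≡ hopDist top w + hops (just ρ) (rail v) (gap top v))
             (parity-suc ⌊ toℕ j /2⌋) eq)

-- Light squares: two resolving vertices

module Light (m : ℕ) where
  open Colour m 0ℙ public
  open Twins zero refl public

  -- The twins reveal the rail, and one of them is compatible with it. Gaps from column 0 are the
  -- column numbers themselves, so the strictly growing distance from that twin fixes the column.
  twins-resolve : ∀ v w → hopDist top v ≡ hopDist top w → hopDist bottom v ≡ hopDist bottom w →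
                  v ≡ w
  twins-resolve v w top≡ bottom≡ =
    position-by-order v w r≡ (ordered v w r≡ top≡ bottom≡) (ordered w v (sym r≡) (sym top≡) (sym bottom≡))
    where
    r≡ : rail v ≡ rail w
    r≡ = same-rails v w (cong₂ _+_ top≡ (sym bottom≡))

    compatible : ∀ r → Compatible (rail top) r ⊎ Compatible (rail bottom) r
    compatible nothing   = inj₁ centre
    compatible (just 0ℙ) = inj₁ same
    compatible (just 1ℙ) = inj₂ same

    ordered : ∀ v w → rail v ≡ rail w → hopDist top v ≡ hopDist top w →
              hopDist bottom v ≡ hopDist bottom w → ¬ col v < col w
    ordered v w r≡ top≡ bottom≡ lt with compatible (rail v)
    ... | inj₁ c = <⇒≢ (hopDist-strict top v w c r≡ lt) top≡
    ... | inj₂ c = <⇒≢ (hopDist-strict bottom v w c r≡ lt) bottom≡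

-- Dark squares: three doubly resolving vertices

∣-∣-antitone : ∀ {e k l} → parity k ≡ parity l → k < l → l ≤ suc e → ∣ e - l ∣ ≤ ∣ e - k ∣
∣-∣-antitone {e} {k} {l} k~l k<l l≤1+e with m≤n⇒m<n∨m≡n l≤1+e
... | inj₁ (s≤s l≤e) = begin
  ∣ e - l ∣  ≡⟨ m≤n⇒∣n-m∣≡n∸m l≤e ⟩
  e ∸ l      ≤⟨ ∸-monoʳ-≤ e (<⇒≤ k<l) ⟩
  e ∸ k      ≤⟨ m∸n≤∣m-n∣ e k ⟩
  ∣ e - k ∣  ∎
  where open ≤-Reasoning
-- Here `l` overshoots `e` by one, but equal parity puts `k` at least two below `l`, hence strictly
-- below `e`.
... | inj₂ refl = begin
  ∣ e - suc e ∣  ≡⟨ trans (∣-∣-comm e (suc e)) (∣m+n-n∣≡m 1 e) ⟩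
  1              ≤⟨ m<n⇒0<n∸m (≤-pred (parity-gap k~l k<l)) ⟩
  e ∸ k          ≤⟨ m∸n≤∣m-n∣ e k ⟩
  ∣ e - k ∣      ∎
  where open ≤-Reasoning

module Dark (m : ℕ) where
  open Colour m 1ℙ public

  -- The last column is `2 + m`, of the parity of `m`; if it is even, `1 + m` is taken. At most one
  -- column lies beyond.
  lastOdd : Σ[ j ∈ Fin n ] (parity (toℕ j) ≡ 1ℙ × n ≤ 2 + toℕ j)
  lastOdd with parity m in eq
  ... | 1ℙ = fromℕ< (≤-refl {n}) ,
             subst (λ j → parity j ≡ 1ℙ × n ≤ 2 + j) (sym (toℕ-fromℕ< (≤-refl {n}))) (eq , n≤1+n n)
  ... | 0ℙ = fromℕ< (n≤1+n (2 + m)) ,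
             subst (λ j → parity j ≡ 1ℙ × n ≤ 2 + j) (sym (toℕ-fromℕ< (n≤1+n (2 + m))))
                   (trans (parity-suc m) (cong _⁻¹ eq) , ≤-refl)

  open Twins (proj₁ lastOdd) (proj₁ (proj₂ lastOdd)) public

  first : V
  first = (suc zero , zero) , [ refl ]

  first≢top : first ≢ top
  first≢top ()

  first≢bottom : first ≢ bottom
  first≢bottom ()

  -- The twins reveal the rail. On a fixed rail, moving right strictly raises the distance from
  -- `first`, whose middle row is compatible with every rail, and never raises that from `top`;
  -- their difference thus fixes the column.
  doubly-resolve : ∀ v w →
    hopDist first v + hopDist top w ≡ hopDist first w + hopDist top v →
    hopDist top v + hopDist bottom w ≡ hopDist top w + hopDist bottom v → v ≡ w
  doubly-resolve v w ends twins =
    position-by-order v w r≡ (ordered v w r≡ ends) (ordered w v (sym r≡) (sym ends))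
    where
    r≡ : rail v ≡ rail w
    r≡ = same-rails v w twins

    ordered : ∀ v w → rail v ≡ rail w →
              hopDist first v + hopDist top w ≡ hopDist first w + hopDist top v →
              ¬ col v < col w
    ordered v w r≡ ends lt = <⇒≢
      (+-mono-<-≤
        (hopDist-strict first v w middle r≡ lt)
        (hopDist-mono top w v (sym r≡)
          (∣-∣-antitone
            (trans (parity-gap-sides first v)
              (trans (cong (λ r → 1ℙ +ℙ side r) r≡) (sym (parity-gap-sides first w))))
            lt (≤-pred (≤-trans (toℕ<n (column w)) (proj₂ (proj₂ lastOdd)))))))
      ends

-- The game graph on three rows

theorem5p5 : (n : ℕ) → 3 ≤ n →
    ∃[ β ] (IsMetricDimension (twoBishopGame 3 n) β × 3 ≤ β × β ≤ 4)
theorem5p5 (suc (suc (suc m))) (s≤s (s≤s (s≤s z≤n))) =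
  metricDimension-3-4 game (≡-dec L._≟ᵛ_ D._≟ᵛ_) (search-× L.search-V D.search-V)
    (resolving⇒3≤ game (L.top , D.first)
      (neighbours-□ L.distance D.distance L.neighbours D.neighbours))
    (_ , resolving-□ L.distance D.distance L.twins-resolve D.doubly-resolve
           L.top≢bottom D.first≢top D.first≢bottom D.top≢bottom)
  where
  module L = Light m
  module D = Dark m
  game = distance-□ L.distance D.distance
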